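{- Let $G$ be a finite simple graph with $n=|V(G)|$, and let $v_1,\dots,v_r$ be a $\beta$-sequence in $G$ such that $d(v_1)+\dots+d(v_r)\le (r-1)n$. Then $r\ge W(G)$.
   Context: Graphs are finite, undirected, without loops or multiple edges; $N(v)$ is the set of vertices adjacent to $v$, $d(v)=|N(v)|$, and $N(v_1,\dots,v_k)=\bigcap_{j=1}^k N(v_j)$. Define $W(G)=\sum_{v\in V(G)}\frac{1}{n-d(v)}$. A sequence $v_1,\dots,v_r$ of vertices is a $\beta$-sequence in $G$ if (i) $d(v_1)=\max\{d(v)\mid v\in V(G)\}$, and (ii) for $2\le i\le r$, $v_i\in N(v_1,\dots,v_{i-1})$ and $d(v_i)=\max\{d(v)\mid v\in N(v_1,\dots,v_{i-1})\}$ (degrees taken in $G$). -}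

module Defs where

open import Data.Fin.Base using (Fin; zero; suc; inject)
open import Data.Fin.Subset using (Subset; _∈_; _∉_; _∩_; ⊤; ∣_∣)
open import Data.Fin.Subset.Properties using (∈⊤; ∣⊤∣≡n; p⊂q⇒∣p∣<∣q∣)
open import Data.Integer.Base using (+_)
open import Data.Nat.Base using (ℕ; suc; _∸_; _≤_; _<_; NonZero; >-nonZero)
open import Data.Nat.Properties using (m<n⇒0<n∸m)
open import Data.Product.Base using (_×_; _,_)
open import Data.Rational.Base using (ℚ; _/_)
open import Data.Rational.Properties using (+-0-commutativeMonoid)
open import Data.Vec.Base using (tabulate)
open import Data.Vec.Functional using (Vector; foldr)
open import Data.Vec.Properties using (lookup∘tabulate; []=⇒lookup)
open import Level using (0ℓ)
open import Relation.Binary.Core using (Rel)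
open import Relation.Binary.Definitions using (Decidable; Irreflexive; Symmetric)
open import Relation.Binary.PropositionalEquality using (_≡_; refl; sym; trans; subst)
open import Relation.Nullary.Decidable using (does; proof)
open import Relation.Nullary.Reflects using (Reflects; invert)
import Algebra.Properties.CommutativeMonoid.Sum +-0-commutativeMonoid as ℚ-Sum

record Graph (n : ℕ) : Set₁ where
  field
    Adj        : Rel (Fin n) 0ℓ
    adj?       : Decidable Adj
    adj-sym    : Symmetric Adj
    adj-irrefl : Irreflexive _≡_ Adj

  N : Fin n → Subset n
  N v = tabulate (λ u → does (adj? v u))

  d : Fin n → ℕ
  d v = ∣ N v ∣

  ⋂N : ∀ {k} → Vector (Fin n) k → Subset n
  ⋂N vs = foldr (λ v S → N v ∩ S) ⊤ vs

  ∈N⇒Adj : ∀ {u v} → u ∈ N v → Adj v u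
  ∈N⇒Adj {u} {v} u∈Nv = invert (subst (Reflects (Adj v u))
    (trans (sym (lookup∘tabulate (λ w → does (adj? v w)) u)) ([]=⇒lookup u∈Nv))
    (proof (adj? v u)))

  v∉Nv : ∀ v → v ∉ N v
  v∉Nv v v∈Nv = adj-irrefl refl (∈N⇒Adj v∈Nv)

  d<n : ∀ v → d v < n
  d<n v = subst (d v <_) (∣⊤∣≡n n)
    (p⊂q⇒∣p∣<∣q∣ ((λ _ → ∈⊤) , v , ∈⊤ , v∉Nv v))

  n∸d-nonZero : ∀ v → NonZero (n ∸ d v)
  n∸d-nonZero v = >-nonZero (m<n⇒0<n∸m (d<n v))

  W : ℚ
  W = ℚ-Sum.sum (λ v → _/_ (+ 1) (n ∸ d v) {{n∸d-nonZero v}})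

  HasMaxDegreeIn : Fin n → Subset n → Set
  HasMaxDegreeIn v S = v ∈ S × (∀ {u} → u ∈ S → d u ≤ d v)

  -- A β-sequence has at least one term, hence the length suc m;
  -- λ j → v (inject {i = suc i} j) is the part of v strictly before suc i.
  record IsβSequence {m} (v : Vector (Fin n) (suc m)) : Set where
    field
      first : HasMaxDegreeIn (v zero) ⊤
      next  : ∀ (i : Fin m) →
              HasMaxDegreeIn (v (suc i)) (⋂N (λ j → v (inject {i = suc i} j)))

{-# OPTIONS --safe #-}

-- Write kᵢ = n − d(vᵢ) and let S be the current common neighbourhood N(v₁,…,vᵢ₋₁).
-- Every u ∈ S has 1/(n − d(u)) ≤ 1/kᵢ, and at most kᵢ vertices leave S when it is
-- intersected with N(vᵢ), so vᵢ accounts for a weight of at most kᵢ · 1/kᵢ = 1.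
-- When x < kᵢ vertices leave, the unused kᵢ − x units become slack for the vertices
-- left over at the end, whose weights are still at most 1/kᵢ.  The hypothesis says
-- that ∑ kᵢ ≥ n, so no slack is needed initially.
module Submission where

open import Defs
open import Data.Nat.Properties using (+-0-commutativeMonoid)
open import Algebra.Properties.CommutativeMonoid.Sum +-0-commutativeMonoid using (sum)
open import Data.Fin.Base using (Fin)
open import Data.Integer.Base using (+_)
open import Data.Nat.Base using (ℕ; suc; _∸_; _*_; _≤_)
open import Data.Rational.Base as ℚ using (_/_)
open import Data.Vec.Functional using (Vector)

import Algebra.Properties.CommutativeMonoid.Sum as CommutativeMonoidSum
import Algebra.Properties.Monoid.Mult as Mult
import Data.Integer.Base as ℤ
import Data.Integer.Properties as ℤ
import Data.Nat.Properties as ℕ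
import Data.Rational.Properties as ℚ
import Data.Rational.Unnormalised.Base as ℚᵘ
import Data.Rational.Unnormalised.Properties as ℚᵘ
open import Algebra.Bundles using (CommutativeMonoid)
open import Algebra.Properties.CommutativeSemigroup ℕ.+-commutativeSemigroup using (interchange)
open import Data.Bool.Base using (true; false)
open import Data.Fin.Base using (zero; suc; inject)
open import Data.Fin.Subset using (Subset; _∈_; _∩_; ∁; ⊤; ∣_∣)
open import Data.Fin.Subset.Properties
  using (∣⊤∣≡n; x∈p∩q⁻; ∣p∩q∣≤∣q∣; ∣∁p∣≡n∸∣p∣; ∩-assoc; ∩-identityˡ; ∩-identityʳ)
open import Data.Integer.Tactic.RingSolver using (solve-∀)
open import Data.Nat.Base using (zero; _+_; z≤n; s≤s; NonZero)
open import Data.Product.Base using (proj₁; proj₂)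
open import Data.Rational.Base using (ℚ; 0ℚ; 1ℚ)
open import Data.Vec.Base using ([]; _∷_; here; there)
open import Data.Vec.Functional using (tail)
open import Function.Base using (_∘_)
open import Relation.Binary.PropositionalEquality
  using (_≡_; refl; sym; trans; cong; cong₂; subst; module ≡-Reasoning)

private
  module ℚ-Sum = CommutativeMonoidSum ℚ.+-0-commutativeMonoid
  module ℚ-Mult = Mult (CommutativeMonoid.monoid ℚ.+-0-commutativeMonoid)

open ℚ-Mult using () renaming (_×_ to _·_)

·-monoˡ-≤ : ∀ {m n p} → 0ℚ ℚ.≤ p → m ≤ n → m · p ℚ.≤ n · p
·-monoˡ-≤ {n = zero}  0≤p z≤n       = ℚ.≤-refl
·-monoˡ-≤ {n = suc n} 0≤p z≤n       = ℚ.+-mono-≤ 0≤p (·-monoˡ-≤ {n = n} 0≤p z≤n)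
·-monoˡ-≤ {p = p}     0≤p (s≤s m≤n) = ℚ.+-monoʳ-≤ p (·-monoˡ-≤ 0≤p m≤n)

·-monoʳ-≤ : ∀ n {p q} → p ℚ.≤ q → n · p ℚ.≤ n · q
·-monoʳ-≤ zero    p≤q = ℚ.≤-refl
·-monoʳ-≤ (suc n) p≤q = ℚ.+-mono-≤ p≤q (·-monoʳ-≤ n p≤q)

0≤1/n : ∀ n .{{_ : NonZero n}} → 0ℚ ℚ.≤ + 1 / n
0≤1/n n = ℚ.nonNegative⁻¹ _ {{ℚ.normalize-nonNeg 1 n}}

-- Among unnormalised rationals the comparison is cross-multiplication, which avoids the gcds hidden
-- in `/`.
1/-anti-≤ : ∀ {m n} .{{_ : NonZero m}} .{{_ : NonZero n}} → m ≤ n → + 1 / n ℚ.≤ + 1 / m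
1/-anti-≤ {m@(suc _)} {n@(suc _)} m≤n = ℚ.toℚᵘ-cancel-≤ (begin
  ℚ.toℚᵘ (+ 1 / n)      ≃⟨ ℚ.toℚᵘ-fromℚᵘ (+ 1 ℚᵘ./ n) ⟩
  + 1 ℚᵘ./ n            ≤⟨ ℚᵘ.*≤* (ℤ.*-monoˡ-≤-nonNeg (+ 1) (ℤ.+≤+ m≤n)) ⟩
  + 1 ℚᵘ./ m            ≃⟨ ℚ.toℚᵘ-fromℚᵘ (+ 1 ℚᵘ./ m) ⟨
  ℚ.toℚᵘ (+ 1 / m)      ∎)
  where open ℚᵘ.≤-Reasoning

-- Serves twice: `m` equal to `n` makes the share of one vertex of the sequence exactly 1, and `n`
-- equal to 1 identifies the final multiple of `1ℚ` with a fraction.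
·1/n≡/n : ∀ m n .{{_ : NonZero n}} → m · (+ 1 / n) ≡ + m / n
·1/n≡/n zero    n@(suc _) = ℚ.fromℚᵘ-cong {ℚᵘ.0ℚᵘ} {+ 0 ℚᵘ./ n} (ℚᵘ.*≡* refl)
·1/n≡/n (suc m) n@(suc _) = ℚ.toℚᵘ-injective (begin-equality
  ℚ.toℚᵘ (+ 1 / n ℚ.+ m · (+ 1 / n))        ≡⟨ cong (λ p → ℚ.toℚᵘ (+ 1 / n ℚ.+ p)) (·1/n≡/n m n) ⟩
  ℚ.toℚᵘ (+ 1 / n ℚ.+ + m / n)              ≃⟨ ℚ.toℚᵘ-homo-+ (+ 1 / n) (+ m / n) ⟩
  ℚ.toℚᵘ (+ 1 / n) ℚᵘ.+ ℚ.toℚᵘ (+ m / n)    ≃⟨ ℚᵘ.+-cong (ℚ.toℚᵘ-fromℚᵘ (+ 1 ℚᵘ./ n)) (ℚ.toℚᵘ-fromℚᵘ (+ m ℚᵘ./ n)) ⟩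
  + 1 ℚᵘ./ n ℚᵘ.+ + m ℚᵘ./ n                ≃⟨ ℚᵘ.*≡* (common (+ m) (+ n)) ⟩
  + suc m ℚᵘ./ n                            ≃⟨ ℚ.toℚᵘ-fromℚᵘ (+ suc m ℚᵘ./ n) ⟨
  ℚ.toℚᵘ (+ suc m / n)                      ∎)
  where
  open ℚᵘ.≤-Reasoning
  common : ∀ i j → (+ 1 ℤ.* j ℤ.+ i ℤ.* j) ℤ.* j ≡ (+ 1 ℤ.+ i) ℤ.* (j ℤ.* j)
  common = solve-∀

n·1/n≡1 : ∀ n .{{_ : NonZero n}} → n · (+ 1 / n) ≡ 1ℚ
n·1/n≡1 n@(suc _) = trans (·1/n≡/n n n)
  (ℚ.fromℚᵘ-cong {+ n ℚᵘ./ n} {ℚᵘ.1ℚᵘ} (ℚᵘ.*≡* (ℤ.*-comm (+ n) (+ 1))))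

∣p∩q∣+∣p∩∁q∣≡∣p∣ : ∀ {n} (p q : Subset n) → ∣ p ∩ q ∣ + ∣ p ∩ ∁ q ∣ ≡ ∣ p ∣
∣p∩q∣+∣p∩∁q∣≡∣p∣ []          []          = refl
∣p∩q∣+∣p∩∁q∣≡∣p∣ (false ∷ p) (_     ∷ q) = ∣p∩q∣+∣p∩∁q∣≡∣p∣ p q
∣p∩q∣+∣p∩∁q∣≡∣p∣ (true  ∷ p) (true  ∷ q) = cong suc (∣p∩q∣+∣p∩∁q∣≡∣p∣ p q)
∣p∩q∣+∣p∩∁q∣≡∣p∣ (true  ∷ p) (false ∷ q) =
  trans (ℕ.+-suc ∣ p ∩ q ∣ ∣ p ∩ ∁ q ∣) (cong suc (∣p∩q∣+∣p∩∁q∣≡∣p∣ p q))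

-- Recursion along the subset itself, so that splitting and bounding are structural inductions
-- matching the computation of `∣_∣`.
sumOver : ∀ {n} → Subset n → Vector ℚ n → ℚ
sumOver []          f = 0ℚ
sumOver (true  ∷ p) f = f zero ℚ.+ sumOver p (tail f)
sumOver (false ∷ p) f = sumOver p (tail f)

sumOver-⊤ : ∀ {n} (f : Vector ℚ n) → sumOver ⊤ f ≡ ℚ-Sum.sum f
sumOver-⊤ {zero}  f = refl
sumOver-⊤ {suc n} f = cong (f zero ℚ.+_) (sumOver-⊤ (tail f))

sumOver-split : ∀ {n} (p q : Subset n) (f : Vector ℚ n) →
                sumOver p f ≡ sumOver (p ∩ ∁ q) f ℚ.+ sumOver (p ∩ q) f
sumOver-split []          []          f = refl
sumOver-split (false ∷ p) (_     ∷ q) f = sumOver-split p q (tail f)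
sumOver-split (true  ∷ p) (false ∷ q) f =
  trans (cong (f zero ℚ.+_) (sumOver-split p q (tail f))) (sym (ℚ.+-assoc (f zero) _ _))
sumOver-split (true  ∷ p) (true  ∷ q) f = begin
  f zero ℚ.+ sumOver p (tail f)  ≡⟨ cong (f zero ℚ.+_) (sumOver-split p q (tail f)) ⟩
  f zero ℚ.+ (a ℚ.+ b)           ≡⟨ ℚ.+-assoc (f zero) a b ⟨
  (f zero ℚ.+ a) ℚ.+ b           ≡⟨ cong (ℚ._+ b) (ℚ.+-comm (f zero) a) ⟩
  (a ℚ.+ f zero) ℚ.+ b           ≡⟨ ℚ.+-assoc a (f zero) b ⟩
  a ℚ.+ (f zero ℚ.+ b)           ∎
  where
  open ≡-Reasoning
  a = sumOver (p ∩ ∁ q) (tail f)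
  b = sumOver (p ∩ q) (tail f)

sumOver-≤ : ∀ {n} (p : Subset n) {f : Vector ℚ n} {c} →
            (∀ {u} → u ∈ p → f u ℚ.≤ c) → sumOver p f ℚ.≤ ∣ p ∣ · c
sumOver-≤ []          f≤c = ℚ.≤-refl
sumOver-≤ (true  ∷ p) f≤c = ℚ.+-mono-≤ (f≤c here) (sumOver-≤ p (f≤c ∘ there))
sumOver-≤ (false ∷ p) f≤c = sumOver-≤ p (f≤c ∘ there)

module _ {n} (G : Graph n) where
  open Graph G

  weight : Vector ℚ n
  weight v = _/_ (+ 1) (n ∸ d v) {{n∸d-nonZero v}}

  weight-mono : ∀ {u v} → d u ≤ d v → weight u ℚ.≤ weight v
  weight-mono {u} {v} du≤dv =
    1/-anti-≤ {{n∸d-nonZero v}} {{n∸d-nonZero u}} (ℕ.∸-monoʳ-≤ n du≤dv)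

  -- Relativising to `S` makes the notion stable under dropping the first term, as an induction on
  -- the length requires. The empty prefix contributes `⊤`, so the first term needs no separate
  -- clause and length zero is allowed.
  IsβSequenceIn : ∀ {k} → Subset n → Vector (Fin n) k → Set
  IsβSequenceIn {k} S v =
    ∀ (i : Fin k) → HasMaxDegreeIn (v i) (S ∩ ⋂N (λ j → v (inject {i = i} j)))

  IsβSequenceIn-head : ∀ {k S} {v : Vector (Fin n) (suc k)} →
                       IsβSequenceIn S v → HasMaxDegreeIn (v zero) S
  IsβSequenceIn-head {S = S} β = subst (HasMaxDegreeIn _) (∩-identityʳ S) (β zero)

  IsβSequenceIn-tail : ∀ {k S} {v : Vector (Fin n) (suc k)} →
                       IsβSequenceIn S v → IsβSequenceIn (S ∩ N (v zero)) (tail v)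
  IsβSequenceIn-tail {S = S} {v} β i =
    -- The prefix before `suc i` starts with `v zero`, so its `⋂N` unfolds to `N (v zero)`
    -- intersected with the prefix of the tail; only the bracketing differs.
    subst (HasMaxDegreeIn _) (sym (∩-assoc S (N (v zero)) _)) (β (suc i))

  IsβSequence⇒IsβSequenceIn-⊤ : ∀ {m} {v : Vector (Fin n) (suc m)} →
                                IsβSequence v → IsβSequenceIn ⊤ v
  IsβSequence⇒IsβSequenceIn-⊤ β zero    =
    subst (HasMaxDegreeIn _) (sym (∩-identityʳ ⊤)) (IsβSequence.first β)
  IsβSequence⇒IsβSequenceIn-⊤ β (suc i) =
    subst (HasMaxDegreeIn _) (sym (∩-identityˡ _)) (IsβSequence.next β i)

  ∣p∩∁N∣≤n∸d : ∀ p v → ∣ p ∩ ∁ (N v) ∣ ≤ n ∸ d v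
  ∣p∩∁N∣≤n∸d p v = ℕ.≤-trans (∣p∩q∣≤∣q∣ p (∁ (N v))) (ℕ.≤-reflexive (∣∁p∣≡n∸∣p∣ (N v)))

  -- The subtraction is not truncated, since the vertices leaving `S` all lie outside `N v`. The
  -- identity is applied both to cardinalities and to multiples of a weight.
  absorb-slack : ∀ S v slack →
                 ∣ S ∩ ∁ (N v) ∣ + (slack + (n ∸ d v ∸ ∣ S ∩ ∁ (N v) ∣)) ≡ slack + (n ∸ d v)
  absorb-slack S v slack = begin
    x + (slack + (k ∸ x))   ≡⟨ ℕ.+-comm x _ ⟩
    slack + (k ∸ x) + x     ≡⟨ ℕ.+-assoc slack (k ∸ x) x ⟩
    slack + (k ∸ x + x)     ≡⟨ cong (λ l → slack + l) (ℕ.m∸n+n≡m (∣p∩∁N∣≤n∸d S v)) ⟩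
    slack + k               ∎
    where
    open ≡-Reasoning
    k = n ∸ d v
    x = ∣ S ∩ ∁ (N v) ∣

  -- Preserves the counting hypothesis through one step of the induction: the vertices that leave
  -- `S` are cancelled from both sides.
  ∣p∩N∣≤ : ∀ S v slack {t} → ∣ S ∣ ≤ slack + (n ∸ d v + t) →
           ∣ S ∩ N v ∣ ≤ slack + (n ∸ d v ∸ ∣ S ∩ ∁ (N v) ∣) + t
  ∣p∩N∣≤ S v slack {t} ∣S∣≤ = ℕ.+-cancelˡ-≤ x _ _ (begin
    x + ∣ S ∩ N v ∣               ≡⟨ ℕ.+-comm x _ ⟩
    ∣ S ∩ N v ∣ + x               ≡⟨ ∣p∩q∣+∣p∩∁q∣≡∣p∣ S (N v) ⟩
    ∣ S ∣                         ≤⟨ ∣S∣≤ ⟩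
    slack + (k + t)               ≡⟨ ℕ.+-assoc slack k t ⟨
    slack + k + t                 ≡⟨ cong (_+ t) (absorb-slack S v slack) ⟨
    x + (slack + (k ∸ x)) + t     ≡⟨ ℕ.+-assoc x _ t ⟩
    x + (slack + (k ∸ x) + t)     ∎)
    where
    open ℕ.≤-Reasoning
    k = n ∸ d v
    x = ∣ S ∩ ∁ (N v) ∣

  -- Induction on the length with `S`, `slack` and `c` all varying: each unit of slack pays for one
  -- leftover vertex at the price `c`, and each term of the sequence pays 1.
  sumOver-weight-≤ : ∀ {k S} {v : Vector (Fin n) k} {c} slack →
                     IsβSequenceIn S v → 0ℚ ℚ.≤ c → (∀ {u} → u ∈ S → weight u ℚ.≤ c) →
                     ∣ S ∣ ≤ slack + sum (λ i → n ∸ d (v i)) →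
                     sumOver S weight ℚ.≤ slack · c ℚ.+ k · 1ℚ
  sumOver-weight-≤ {zero} {S} {c = c} slack β 0≤c w≤c ∣S∣≤ = begin
    sumOver S weight   ≤⟨ sumOver-≤ S w≤c ⟩
    ∣ S ∣ · c          ≤⟨ ·-monoˡ-≤ 0≤c (ℕ.≤-trans ∣S∣≤ (ℕ.≤-reflexive (ℕ.+-identityʳ slack))) ⟩
    slack · c          ≡⟨ ℚ.+-identityʳ (slack · c) ⟨
    slack · c ℚ.+ 0ℚ   ∎
    where open ℚ.≤-Reasoning
  sumOver-weight-≤ {suc k} {S} {v} {c} slack β 0≤c w≤c ∣S∣≤ = begin
    sumOver S weight
      ≡⟨ sumOver-split S (N v₀) weight ⟩
    sumOver (S ∩ ∁ (N v₀)) weight ℚ.+ sumOver (S ∩ N v₀) weight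
      ≤⟨ ℚ.+-mono-≤
           (sumOver-≤ (S ∩ ∁ (N v₀)) (w≤w₀ ∘ proj₁ ∘ x∈p∩q⁻ S (∁ (N v₀))))
           (sumOver-weight-≤ slack′ (IsβSequenceIn-tail {v = v} β)
             (0≤1/n (n ∸ d v₀) {{n∸d-nonZero v₀}})
             (w≤w₀ ∘ proj₁ ∘ x∈p∩q⁻ S (N v₀)) (∣p∩N∣≤ S v₀ slack ∣S∣≤)) ⟩
    x · w₀ ℚ.+ (slack′ · w₀ ℚ.+ k · 1ℚ)
      ≡⟨ ℚ.+-assoc (x · w₀) (slack′ · w₀) (k · 1ℚ) ⟨
    (x · w₀ ℚ.+ slack′ · w₀) ℚ.+ k · 1ℚ
      -- Departed vertices and new slack are both priced at `w₀`, so they merge and regroup as the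
      -- old slack plus the full `k₀` units, which together weigh 1.
      ≡⟨ cong (ℚ._+ k · 1ℚ) (ℚ-Mult.×-homo-+ w₀ x slack′) ⟨
    (x + slack′) · w₀ ℚ.+ k · 1ℚ
      ≡⟨ cong (λ l → l · w₀ ℚ.+ k · 1ℚ) (absorb-slack S v₀ slack) ⟩
    (slack + k₀) · w₀ ℚ.+ k · 1ℚ
      ≡⟨ cong (ℚ._+ k · 1ℚ) (ℚ-Mult.×-homo-+ w₀ slack k₀) ⟩
    (slack · w₀ ℚ.+ k₀ · w₀) ℚ.+ k · 1ℚ
      ≡⟨ ℚ.+-assoc (slack · w₀) (k₀ · w₀) (k · 1ℚ) ⟩
    slack · w₀ ℚ.+ (k₀ · w₀ ℚ.+ k · 1ℚ)
      ≡⟨ cong (λ p → slack · w₀ ℚ.+ (p ℚ.+ k · 1ℚ)) (n·1/n≡1 k₀ {{n∸d-nonZero v₀}}) ⟩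
    slack · w₀ ℚ.+ suc k · 1ℚ
      -- As `v₀` itself lies in `S`, its weight is at most `c`, which restores the old price of the
      -- old slack.
      ≤⟨ ℚ.+-monoˡ-≤ (suc k · 1ℚ) (·-monoʳ-≤ slack (w≤c (proj₁ v₀-max))) ⟩
    slack · c ℚ.+ suc k · 1ℚ
      ∎
    where
    open ℚ.≤-Reasoning
    v₀     = v zero
    w₀     = weight v₀
    k₀     = n ∸ d v₀
    x      = ∣ S ∩ ∁ (N v₀) ∣
    slack′ = slack + (k₀ ∸ x)
    v₀-max = IsβSequenceIn-head {v = v} β

    w≤w₀ : ∀ {u} → u ∈ S → weight u ℚ.≤ w₀
    w≤w₀ = weight-mono ∘ proj₂ v₀-max

  ∑n∸d+∑d≡k*n : ∀ {k} (v : Vector (Fin n) k) →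
                sum (λ i → n ∸ d (v i)) + sum (λ i → d (v i)) ≡ k * n
  ∑n∸d+∑d≡k*n {zero}  v = refl
  ∑n∸d+∑d≡k*n {suc k} v = begin
    (k₀ + ∑k) + (d₀ + ∑d)   ≡⟨ interchange k₀ ∑k d₀ ∑d ⟩
    (k₀ + d₀) + (∑k + ∑d)   ≡⟨ cong₂ _+_ (ℕ.m∸n+n≡m (ℕ.<⇒≤ (d<n (v zero)))) (∑n∸d+∑d≡k*n (tail v)) ⟩
    n + k * n               ∎
    where
    open ≡-Reasoning
    k₀ = n ∸ d (v zero)
    d₀ = d (v zero)
    ∑k = sum (λ i → n ∸ d (tail v i))
    ∑d = sum (λ i → d (tail v i))

  -- The codegrees and degrees add up to `suc m * n`, which unfolds to `n + m * n`; the degrees use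
  -- up at most `m * n` of it.
  n≤∑n∸d : ∀ {m} (v : Vector (Fin n) (suc m)) →
           sum (λ i → d (v i)) ≤ m * n → n ≤ sum (λ i → n ∸ d (v i))
  n≤∑n∸d {m} v ∑d≤mn = ℕ.+-cancelʳ-≤ (m * n) _ _ (begin
    n + m * n                                        ≡⟨ ∑n∸d+∑d≡k*n v ⟨
    sum (λ i → n ∸ d (v i)) + sum (λ i → d (v i))    ≤⟨ ℕ.+-monoʳ-≤ _ ∑d≤mn ⟩
    sum (λ i → n ∸ d (v i)) + m * n                  ∎)
    where open ℕ.≤-Reasoning

theorem2 : ∀ {n} (G : Graph n) → let open Graph G in
    (m : ℕ) → let r = suc m in
    (v : Vector (Fin n) r) → IsβSequence v →
    sum (λ i → d (v i)) ≤ (r ∸ 1) * n →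
    + r / 1 ℚ.≥ W
theorem2 {n} G m v β ∑d≤mn = begin
  W                          ≡⟨ sumOver-⊤ (weight G) ⟨
  -- Here `c` is the weight of `v zero`, a bound on all vertices by `first`; with slack 0 its
  -- multiple reduces to `0ℚ`.
  sumOver ⊤ (weight G)       ≤⟨ sumOver-weight-≤ G 0 (IsβSequence⇒IsβSequenceIn-⊤ G β)
                                  (0≤1/n (n ∸ d (v zero)) {{n∸d-nonZero (v zero)}})
                                  (weight-mono G ∘ proj₂ (IsβSequence.first β))
                                  (ℕ.≤-trans (ℕ.≤-reflexive (∣⊤∣≡n n)) (n≤∑n∸d G v ∑d≤mn)) ⟩
  0ℚ ℚ.+ suc m · 1ℚ          ≡⟨ ℚ.+-identityˡ (suc m · 1ℚ) ⟩
  suc m · 1ℚ                 ≡⟨ ·1/n≡/n (suc m) 1 ⟩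
  + suc m / 1                ∎
  where
  open Graph G
  open ℚ.≤-Reasoning
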